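{- Let $\mathbf{K}$ be an infinite relational structure and let $\mathbf{A}\in\mathrm{Age}(\mathbf{K})$. If $t_\square((\mathbf{A},\mathbf{A}),\mathbf{K})<\infty$, then there is a finite Ramsey basis $\mathcal{B}\subseteq\mathcal{E}_{\mathbf{K}}(\mathbf{A})$.
   Context: Embeddings are injections preserving relations in both directions; $\binom{\mathbf{B}}{\mathbf{A}}$ is the set of copies of $\mathbf{A}$ in $\mathbf{B}$, i.e. images of embeddings of $\mathbf{A}$ into $\mathbf{B}$; $\mathrm{Age}(\mathbf{K})$ is the class of all finite substructures of $\mathbf{K}$. The box Ramsey degree $t_\square((\mathbf{A},\mathbf{A}),\mathbf{K})$ is the smallest integer $t$, if it exists (otherwise it is $\infty$), such that for every $k\in\omega$ and every $c:\binom{\mathbf{K}}{\mathbf{A}}^2\to k$ there is $\mathbf{K}'\in\binom{\mathbf{K}}{\mathbf{K}}$ with $\left|c\left[\binom{\mathbf{K}'}{\mathbf{A}}^2\right]\right|\le t$. $\mathcal{E}_{\mathbf{K}}(\mathbf{A})$ is the set of equivalence relations on $\binom{\mathbf{K}}{\mathbf{A}}$; for $\mathbb{E}\in\mathcal{E}_{\mathbf{K}}(\mathbf{A})$ and $\mathbf{K}'\in\binom{\mathbf{K}}{\mathbf{K}}$, $\mathbb{E}\upharpoonright\mathbf{K}'$ is the restriction of $\mathbb{E}$ to $\binom{\mathbf{K}'}{\mathbf{A}}$. A set $\mathcal{B}\subseteq\mathcal{E}_{\mathbf{K}}(\mathbf{A})$ is a Ramsey basis if for every $\mathbb{E}\in\mathcal{E}_{\mathbf{K}}(\mathbf{A})$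 there are $\tilde{\mathbb{E}}\in\mathcal{B}$ and $\mathbf{K}'\in\binom{\mathbf{K}}{\mathbf{K}}$ such that $\mathbb{E}\upharpoonright\mathbf{K}'=\tilde{\mathbb{E}}\upharpoonright\mathbf{K}'$. -}

module Defs where

open import Data.Fin using (Fin)
open import Data.Fin.Subset as Subset using (∣_∣)
import Data.List.Membership.Setoid as Membership
open import Data.Nat using (ℕ; _≤_)
open import Data.Product using (_×_; _,_; ∃; ∃-syntax; proj₁; swap)
open import Data.Product.Relation.Binary.Pointwise.NonDependent using (_×ₛ_)
open import Data.Vec as Vec using (Vec)
open import Function using (_∘_; id; _on_)
open import Function.Bundles using (Func; _⟶ₛ_; _↔_; _⇔_)
open import Function.Definitions using (Injective)
open import Level using (Level; suc)
open import Relation.Binary.Bundles using (Setoid)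
open import Relation.Binary.Core using (Rel; _⇒_) renaming (_⇔_ to _⇔ʳ_)
open import Relation.Binary.PropositionalEquality using (_≡_; setoid)
open import Relation.Binary.Structures using (IsEquivalence)
open import Relation.Nullary using (¬_)
open import Relation.Unary using (Pred; _∈_; _≐_)

private variable
  ℓ : Level

record Language (ℓ : Level) : Set (suc ℓ) where
  field
    Symbol : Set ℓ
    arity  : Symbol → ℕ

open Language public

record Structure {ℓ : Level} (L : Language ℓ) : Set (suc ℓ) where
  field
    Carrier : Set ℓ
    rel     : (R : Symbol L) → Pred (Vec Carrier (arity L R)) ℓ

Finite : {L : Language ℓ} → Structure L → Set ℓ
Finite A = ∃[ n ] Structure.Carrier A ↔ Fin n

Infinite : {L : Language ℓ} → Structure L → Set ℓ
Infinite K = ¬ Finite K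

record Embedding {ℓ : Level} {L : Language ℓ} (A B : Structure L) : Set ℓ where
  private
    module A = Structure A
    module B = Structure B
  field
    to        : A.Carrier → B.Carrier
    injective : Injective _≡_ _≡_ to
    preserves : ∀ R (xs : Vec A.Carrier (arity L R)) →
                A.rel R xs ⇔ B.rel R (Vec.map to xs)

open Embedding public using (to)

-- The age is closed under isomorphism here: a finite substructure of K is
-- given abstractly, together with an embedding onto it.
_∈Age_ : {L : Language ℓ} → Structure L → Structure L → Set ℓ
A ∈Age K = Finite A × Embedding A K

module _ {L : Language ℓ} {A B : Structure L} where

  Im : Embedding A B → Pred (Structure.Carrier B) ℓ
  Im f y = ∃[ x ] to f x ≡ y

-- The set (B choose A) of copies of A in B.  A copy is the image of an
-- embedding; it is represented by such an embedding, and two embeddings are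
-- equal as copies exactly when they have the same image.
Copies : {L : Language ℓ} → Structure L → Structure L → Setoid ℓ ℓ
Copies B A = record
  { Carrier       = Embedding A B
  ; _≈_           = λ f g → Im f ≐ Im g
  ; isEquivalence = record
    { refl  = id , id
    ; sym   = swap
    ; trans = λ (p , p′) (q , q′) → (λ z → q (p z)) , (λ z → p′ (q′ z))
    }
  }

∣_∣≤_ : ∀ {k} → Pred (Fin k) ℓ → ℕ → Set ℓ
∣_∣≤_ {k = k} P t =
  ∃[ T ] (∀ (i : Fin k) → (i Subset.∈ T) ⇔ (i ∈ P)) × ∣ T ∣ ≤ t

module _ {L : Language ℓ} (A K : Structure L) where

  open Setoid (Copies K A) using (_≈_) renaming (Carrier to Copy)

  -- The subset (K' choose A) of (K choose A), for K' a copy of K in K: as K'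
  -- carries the structure induced from K, an embedding of A into K' is an
  -- embedding of A into K taking all its values in K'.
  CopiesIn : Embedding K K → Pred Copy ℓ
  CopiesIn K′ f = ∀ a → to f a ∈ Im K′

  Colouring : ℕ → Set ℓ
  Colouring k = (Copies K A ×ₛ Copies K A) ⟶ₛ setoid (Fin k)

  _[_]² : ∀ {k} → Colouring k → Embedding K K → Pred (Fin k) ℓ
  (c [ K′ ]²) i = ∃[ f ] ∃[ g ]
    f ∈ CopiesIn K′ × g ∈ CopiesIn K′ × Func.to c (f , g) ≡ i

  BoxRamseyBound : ℕ → Set ℓ
  BoxRamseyBound t = ∀ k (c : Colouring k) → ∃[ K′ ] ∣ c [ K′ ]² ∣≤ t

  IsBoxRamseyDegree : ℕ → Set ℓ
  IsBoxRamseyDegree t = BoxRamseyBound t × (∀ s → BoxRamseyBound s → t ≤ s)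

  BoxRamseyDegree<∞ : Set ℓ
  BoxRamseyDegree<∞ = ∃[ t ] IsBoxRamseyDegree t

  -- Since copies are taken up to _≈_, a relation on copies has to respect _≈_;
  -- for an equivalence relation this amounts to containing it.
  record EquivRel : Set (suc ℓ) where
    field
      _∼_           : Rel Copy ℓ
      isEquivalence : IsEquivalence _∼_
      respects-≈    : _≈_ ⇒ _∼_

  open EquivRel using (_∼_)

  EquivRels : Setoid (suc ℓ) ℓ
  EquivRels = record
    { Carrier       = EquivRel
    ; _≈_           = λ E F → _∼_ E ⇔ʳ _∼_ F
    ; isEquivalence = record
      { refl  = id , id
      ; sym   = swap
      ; trans = λ (p , p′) (q , q′) → (λ z → q (p z)) , (λ z → p′ (q′ z))
      }
    }

  _↾_ : EquivRel → (K′ : Embedding K K) → Rel (∃ (CopiesIn K′)) ℓ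
  E ↾ K′ = _∼_ E on proj₁

  IsRamseyBasis : Pred EquivRel (suc ℓ) → Set (suc ℓ)
  IsRamseyBasis ℬ =
    ∀ E → ∃[ Ẽ ] Ẽ ∈ ℬ × (∃[ K′ ] (E ↾ K′) ⇔ʳ (Ẽ ↾ K′))

  IsFiniteSet : Pred EquivRel (suc ℓ) → Set (suc ℓ)
  IsFiniteSet ℬ = ∃[ Es ] ∀ E → E ∈ ℬ → E ∈ₗ Es
    where open Membership EquivRels renaming (_∈_ to _∈ₗ_)

{-# OPTIONS --safe #-}

-- By minimality of the box Ramsey degree t some colouring c of pairs of
-- copies keeps at least t colours on every copy of K.  Given an equivalence
-- relation E, colour a pair by its c-colour together with the truth value of E;
-- on some copy K′ at most t of these colours survive.  As c alone shows t
-- colours there, E is a function of c on K′: it coincides with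
-- R_S = {(f , g) | c (f , g) ∈ S} for some set S of colours.  Passing to a
-- subcopy of K once for each of the finitely many S, we may assume that R_S is
-- an equivalence relation on K as soon as it is one on some copy of K.  The
-- relations R_S that are equivalences then form a finite Ramsey basis.

module Submission where

open import Defs
open import Axiom.ExcludedMiddle using (ExcludedMiddle)
open import Data.Product using (_×_; ∃-syntax)
open import Level using (Level)

open import Level using (Lift; lift)
open import Data.Fin using (Fin; zero; suc; combine; quotient)
open import Data.Fin.Patterns using (0F; 1F)
open import Data.Fin.Properties using (_≟_; combine-injectiveʳ; remQuot-combine)
open import Data.Fin.Subset as Subset
  using (Subset; inside; outside; ⁅_⁆; _∪_; _-_; ∣_∣)
open import Data.Fin.Subset.Properties
  using (∉⊥; ∣⊥∣≡0; ∪-identityˡ; p─q⊆p; x∈⁅x⁆; x∈⁅y⁆⇒x≡y;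
         x∈p∪q⁺; x∈p∪q⁻; x∈p∧x≢y⇒x∈p-y; x∈p⇒∣p-x∣<∣p∣)
open import Data.List using (List; []; _∷_; _++_; map)
open import Data.List.Membership.Propositional using () renaming (_∈_ to _∈ₗ_)
open import Data.List.Membership.Propositional.Properties using (∈-map⁺; ∈-++⁺ˡ; ∈-++⁺ʳ)
import Data.List.Relation.Unary.Any as Any
open import Data.Nat using (ℕ; zero; suc; _≤_; _<_; _*_; z≤n; s≤s)
open import Data.Nat.Properties
  using (≤-refl; ≤-reflexive; ≤-trans; <-≤-trans; ≤-<-trans; <⇒≱; ≰⇒>; m≤n⇒m≤1+n)
open import Data.Product using (_,_; ∃; proj₁; proj₂; swap)
open import Data.Sum using (inj₁; inj₂)
open import Data.Vec as Vec using (Vec; []; _∷_; here; there; lookup; tabulate)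
open import Data.Vec.Properties
  using (map-id; map-∘; map-cong; lookup∘tabulate; []=⇒lookup; lookup⇒[]=)
open import Function using (_∘_; id)
open import Function.Bundles using (Func; Equivalence; _⇔_; mk⇔)
open import Relation.Binary.Bundles using (Setoid)
open import Relation.Binary.Core using (Rel)
open import Relation.Binary.Definitions using (Reflexive; Transitive)
open import Relation.Binary.PropositionalEquality
  using (_≡_; _≢_; refl; sym; trans; cong; cong₂; subst)
open import Relation.Binary.Structures using (IsEquivalence)
open import Relation.Nullary using (¬_; Dec; yes; no; contradiction)
open import Relation.Unary using (Pred; _∈_; _≐_)

open Equivalence using () renaming (to to ⇒; from to ⇐)

private variable
  ℓ a : Level
  k m n s t : ℕ

-- Subsets of finite sets: images, preimages and cardinality bounds.

∣⁅x⁆∪p∣≤1+∣p∣ : (x : Fin n) (p : Subset n) → ∣ ⁅ x ⁆ ∪ p ∣ ≤ suc ∣ p ∣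
∣⁅x⁆∪p∣≤1+∣p∣ zero    (inside  ∷ p) rewrite ∪-identityˡ p = m≤n⇒m≤1+n ≤-refl
∣⁅x⁆∪p∣≤1+∣p∣ zero    (outside ∷ p) rewrite ∪-identityˡ p = ≤-refl
∣⁅x⁆∪p∣≤1+∣p∣ (suc x) (inside  ∷ p) = s≤s (∣⁅x⁆∪p∣≤1+∣p∣ x p)
∣⁅x⁆∪p∣≤1+∣p∣ (suc x) (outside ∷ p) = ∣⁅x⁆∪p∣≤1+∣p∣ x p

image : (Fin m → Fin n) → Subset m → Subset n
image π []            = Subset.⊥
image π (inside  ∷ T) = ⁅ π zero ⁆ ∪ image (π ∘ suc) T
image π (outside ∷ T) = image (π ∘ suc) T

∣image∣≤ : (π : Fin m → Fin n) (T : Subset m) → ∣ image π T ∣ ≤ ∣ T ∣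
∣image∣≤ {n = n} π []  = ≤-reflexive (∣⊥∣≡0 n)
∣image∣≤ π (inside  ∷ T) =
  ≤-trans (∣⁅x⁆∪p∣≤1+∣p∣ (π zero) _) (s≤s (∣image∣≤ (π ∘ suc) T))
∣image∣≤ π (outside ∷ T) = ∣image∣≤ (π ∘ suc) T

∈-image⁺ : (π : Fin m → Fin n) {T : Subset m} {x : Fin m} →
           x Subset.∈ T → π x Subset.∈ image π T
∈-image⁺ π {inside  ∷ T} here       = x∈p∪q⁺ (inj₁ (x∈⁅x⁆ _))
∈-image⁺ π {inside  ∷ T} (there x∈) = x∈p∪q⁺ (inj₂ (∈-image⁺ (π ∘ suc) x∈))
∈-image⁺ π {outside ∷ T} (there x∈) = ∈-image⁺ (π ∘ suc) x∈

∈-image⁻ : (π : Fin m → Fin n) (T : Subset m) {i : Fin n} →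
           i Subset.∈ image π T → ∃[ x ] x Subset.∈ T × π x ≡ i
∈-image⁻ π []            i∈ = contradiction i∈ ∉⊥
∈-image⁻ π (inside  ∷ T) i∈ with x∈p∪q⁻ ⁅ π zero ⁆ _ i∈
... | inj₁ i∈⁅⁆ = zero , here , sym (x∈⁅y⁆⇒x≡y _ i∈⁅⁆)
... | inj₂ i∈T  = let x , x∈T , πx≡i = ∈-image⁻ (π ∘ suc) T i∈T in suc x , there x∈T , πx≡i
∈-image⁻ π (outside ∷ T) i∈ =
  let x , x∈T , πx≡i = ∈-image⁻ (π ∘ suc) T i∈ in suc x , there x∈T , πx≡i

∣∣≤-resp-≐ : {P Q : Pred (Fin n) ℓ} → P ≐ Q → ∣ P ∣≤ t → ∣ Q ∣≤ t
∣∣≤-resp-≐ (P⊆Q , Q⊆P) (T , T⇔P , ∣T∣≤t) =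
  T , (λ i → mk⇔ (P⊆Q ∘ ⇒ (T⇔P i)) (⇐ (T⇔P i) ∘ Q⊆P)) , ∣T∣≤t

∣∣≤-mono : {P : Pred (Fin n) ℓ} → s ≤ t → ∣ P ∣≤ s → ∣ P ∣≤ t
∣∣≤-mono s≤t (T , T⇔P , ∣T∣≤s) = T , T⇔P , ≤-trans ∣T∣≤s s≤t

-- Deleting `x` costs one element but loses no value, because `y` still attains `π x`. This count
-- later forces an equivalence relation to be a function of the colour.
∣image∣<-collision : (π : Fin m → Fin n) {P : Pred (Fin m) ℓ} → ∣ P ∣≤ t →
  ∀ {x y} → P x → P y → x ≢ y → π x ≡ π y →
  ∃[ s ] s < t × ∣ (λ i → ∃[ z ] P z × π z ≡ i) ∣≤ s
∣image∣<-collision π {P} (T , T⇔P , ∣T∣≤t) {x} {y} Px Py x≢y πx≡πy =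
  ∣ U ∣ ,
  <-≤-trans (≤-<-trans (∣image∣≤ π (T - x)) (x∈p⇒∣p-x∣<∣p∣ (⇐ (T⇔P x) Px))) ∣T∣≤t ,
  U , (λ i → mk⇔ U⇒ U⇐) , ≤-refl
  where
  U = image π (T - x)

  U⇒ : ∀ {i} → i Subset.∈ U → ∃[ z ] P z × π z ≡ i
  U⇒ i∈U = let z , z∈ , πz≡i = ∈-image⁻ π (T - x) i∈U
            in z , ⇒ (T⇔P z) (p─q⊆p T ⁅ x ⁆ z∈) , πz≡i

  ∈U : ∀ {z} → P z → z ≢ x → π z Subset.∈ U
  ∈U Pz z≢x = ∈-image⁺ π (x∈p∧x≢y⇒x∈p-y (⇐ (T⇔P _) Pz) z≢x)

  U⇐ : ∀ {i} → ∃[ z ] P z × π z ≡ i → i Subset.∈ U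
  U⇐ (z , Pz , refl) with z ≟ x
  ... | yes refl = subst (Subset._∈ U) (sym πx≡πy) (∈U Py (x≢y ∘ sym))
  ... | no z≢x   = ∈U Pz z≢x

preimage : (Fin m → Fin n) → Subset n → Subset m
preimage π T = tabulate (lookup T ∘ π)

∈-preimage : (π : Fin m → Fin n) (T : Subset n) {i : Fin m} →
             i Subset.∈ preimage π T ⇔ π i Subset.∈ T
∈-preimage π T {i} = mk⇔
  (λ i∈ → lookup⇒[]= (π i) T (trans (sym (lookup∘tabulate _ i)) ([]=⇒lookup i∈)))
  (λ πi∈ → lookup⇒[]= i _ (trans (lookup∘tabulate _ i) ([]=⇒lookup πi∈)))

quotient-combine : (i : Fin m) (j : Fin n) → quotient n (combine i j) ≡ i
quotient-combine i j = cong proj₁ (remQuot-combine i j)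

subsets : ∀ n → List (Subset n)
subsets zero    = [] ∷ []
subsets (suc n) = map (outside ∷_) (subsets n) ++ map (inside ∷_) (subsets n)

∈-subsets : (S : Subset n) → S ∈ₗ subsets n
∈-subsets []            = Any.here refl
∈-subsets (outside ∷ S) = ∈-++⁺ˡ (∈-map⁺ (outside ∷_) (∈-subsets S))
∈-subsets (inside  ∷ S) = ∈-++⁺ʳ _ (∈-map⁺ (inside ∷_) (∈-subsets S))

-- One pass through the list: if `P i` holds somewhere below the current point, move there, and
-- antitonicity keeps it; otherwise the implication for `i` is vacuous. Quantifying over all `z`
-- below `y` lets the indices already treated survive later moves.
stabilise : ExcludedMiddle ℓ → {X : Set ℓ} {I : Set a} (_⊑_ : Rel X ℓ) →
  Reflexive _⊑_ → Transitive _⊑_ →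
  (P : I → Pred X ℓ) → (∀ {i x y} → y ⊑ x → P i x → P i y) →
  (is : List I) (x : X) →
  ∃[ y ] y ⊑ x × (∀ {i} → i ∈ₗ is → ∀ {z} → z ⊑ y → P i z → P i y)
stabilise em _⊑_ ⊑-refl ⊑-trans P antitone []       x = x , ⊑-refl , λ ()
stabilise em _⊑_ ⊑-refl ⊑-trans P antitone (i ∷ is) x
  with y , y⊑x , stable ← stabilise em _⊑_ ⊑-refl ⊑-trans P antitone is x
  with em {∃[ z ] z ⊑ y × P i z}
... | yes (z , z⊑y , Piz) = z , ⊑-trans z⊑y y⊑x , λ where
      (Any.here refl) _   _   → Piz
      (Any.there j∈)  w⊑z Pjw → antitone z⊑y (stable j∈ (⊑-trans w⊑z z⊑y) Pjw)
... | no ¬∃ = y , y⊑x , λ where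
      (Any.here refl) z⊑y Piz → contradiction (_ , z⊑y , Piz) ¬∃
      (Any.there j∈)  → stable j∈

indicator : {P : Set ℓ} → Dec P → Fin 2
indicator (yes _) = 1F
indicator (no  _) = 0F

indicator≡1 : {P : Set ℓ} (P? : Dec P) → P ⇔ indicator P? ≡ 1F
indicator≡1 (yes p) = mk⇔ (λ _ → refl) (λ _ → p)
indicator≡1 (no ¬p) = mk⇔ (λ p → contradiction p ¬p) (λ ())

indicator-cong : {P Q : Set ℓ} (P? : Dec P) (Q? : Dec Q) → P ⇔ Q →
                 indicator P? ≡ indicator Q?
indicator-cong (yes p) Q?      P⇔Q = sym (⇒ (indicator≡1 Q?) (⇒ P⇔Q p))
indicator-cong (no ¬p) (yes q) P⇔Q = contradiction (⇐ P⇔Q q) ¬p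
indicator-cong (no ¬p) (no ¬q) P⇔Q = refl

-- Composition of embeddings.

module _ {L : Language ℓ} where

  open Embedding using (injective; preserves)

  idₑ : {B : Structure L} → Embedding B B
  idₑ {B} = record
    { to        = id
    ; injective = id
    ; preserves = λ R xs → mk⇔ (subst (Structure.rel B R) (sym (map-id xs)))
                               (subst (Structure.rel B R) (map-id xs))
    }

  infixr 9 _∘ₑ_
  _∘ₑ_ : {B C D : Structure L} → Embedding C D → Embedding B C → Embedding B D
  _∘ₑ_ {D = D} j f = record
    { to        = to j ∘ to f
    ; injective = injective f ∘ injective j
    ; preserves = λ R xs → mk⇔
        (subst (Structure.rel D R) (sym (map-∘ (to j) (to f) xs))
          ∘ ⇒ (preserves j R _) ∘ ⇒ (preserves f R xs))
        (⇐ (preserves f R xs) ∘ ⇐ (preserves j R _)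
          ∘ subst (Structure.rel D R) (map-∘ (to j) (to f) xs))
    }

  ∘ₑ-cong : {B C D : Structure L} (j : Embedding C D) {f g : Embedding B C} →
            Im f ≐ Im g → Im (j ∘ₑ f) ≐ Im (j ∘ₑ g)
  ∘ₑ-cong j (f⊆g , g⊆f) =
    (λ { (x , refl) → let y , gy≡fx = f⊆g (x , refl) in y , cong (to j) gy≡fx }) ,
    (λ { (x , refl) → let y , fy≡gx = g⊆f (x , refl) in y , cong (to j) fy≡gx })

-- Colourings and their restrictions to copies of K.

module _ {L : Language ℓ} (A K : Structure L) where

  open Setoid (Copies K A) using (_≈_) renaming (Carrier to Copy)
  open EquivRel
  open Embedding using (injective; preserves)

  -- Preimages under `J` form an embedding because `J` respects relations in both directions.
  factor : (J : Embedding K K) (f : Copy) → f ∈ CopiesIn A K J →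
           ∃[ f′ ] J ∘ₑ f′ ≈ f
  factor J f f∈J = f′ , (λ { (x , refl) → x , sym (J-f′ x) }) , (λ { (x , refl) → x , J-f′ x })
    where
    f′-to = proj₁ ∘ f∈J
    J-f′ : ∀ x → to J (f′-to x) ≡ to f x
    J-f′ = proj₂ ∘ f∈J

    map-J-f′ : ∀ {n} (xs : Vec _ n) → Vec.map (to J) (Vec.map f′-to xs) ≡ Vec.map (to f) xs
    map-J-f′ xs = trans (sym (map-∘ _ _ xs)) (map-cong J-f′ xs)

    f′ : Copy
    f′ = record
      { to        = f′-to
      ; injective = λ {x} {y} eq →
          injective f (trans (sym (J-f′ x)) (trans (cong (to J) eq) (J-f′ y)))
      ; preserves = λ R xs → mk⇔
          (⇐ (preserves J R _) ∘ subst (Structure.rel K R) (sym (map-J-f′ xs))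
            ∘ ⇒ (preserves f R xs))
          (⇐ (preserves f R xs) ∘ subst (Structure.rel K R) (map-J-f′ xs)
            ∘ ⇒ (preserves J R _))
      }

  ∼-resp-≈ : (E : EquivRel A K) {f f′ g g′ : Copy} → f ≈ f′ → g ≈ g′ →
             _∼_ E f g → _∼_ E f′ g′
  ∼-resp-≈ E f≈f′ g≈g′ f∼g =
    E.trans (respects-≈ E (swap f≈f′)) (E.trans f∼g (respects-≈ E g≈g′))
    where module E = IsEquivalence (isEquivalence E)

  ⟦_⟧ : Colouring A K k → Copy → Copy → Fin k
  ⟦ c ⟧ f g = Func.to c (f , g)

  ⟦⟧-cong : (c : Colouring A K k) {f f′ g g′ : Copy} → f ≈ f′ → g ≈ g′ →
            ⟦ c ⟧ f g ≡ ⟦ c ⟧ f′ g′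
  ⟦⟧-cong c f≈f′ g≈g′ = Func.cong c (f≈f′ , g≈g′)

  range : Colouring A K k → Pred (Fin k) ℓ
  range c i = ∃[ f ] ∃[ g ] ⟦ c ⟧ f g ≡ i

  -- Up to `_≈_` the copies inside the image of `J` are the `J ∘ₑ f`, so passing to a subcopy
  -- becomes a recolouring of all of `K`.
  restrict : Embedding K K → Colouring A K k → Colouring A K k
  restrict J c = record
    { to   = λ (f , g) → ⟦ c ⟧ (J ∘ₑ f) (J ∘ₑ g)
    ; cong = λ {(f , g)} {(f′ , g′)} (f≈f′ , g≈g′) →
        ⟦⟧-cong c (∘ₑ-cong J {f} {f′} f≈f′) (∘ₑ-cong J {g} {g′} g≈g′)
    }

  []²≐range : (c : Colouring A K k) (J : Embedding K K) →
              _[_]² A K c J ≐ range (restrict J c)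
  []²≐range c J =
    (λ (f , g , f∈J , g∈J , c≡i) →
      let f′ , Jf′≈f = factor J f f∈J
          g′ , Jg′≈g = factor J g g∈J
      in f′ , g′ , trans (⟦⟧-cong c Jf′≈f Jg′≈g) c≡i) ,
    (λ (f , g , c≡i) → J ∘ₑ f , J ∘ₑ g , (λ x → to f x , refl) , (λ x → to g x , refl) , c≡i)

  infix 4 _⊑_
  -- Agreement is pointwise, since a colouring also carries a congruence proof and iterated
  -- restriction matches restriction along the composite only pointwise.
  _⊑_ : Rel (Colouring A K k) ℓ
  c′ ⊑ c = ∃[ J ] ∀ f g → ⟦ c′ ⟧ f g ≡ ⟦ restrict J c ⟧ f g

  ⊑-refl : Reflexive (_⊑_ {k})
  ⊑-refl {x = c} = idₑ , λ f g → ⟦⟧-cong c (id , id) (id , id)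

  ⊑-trans : Transitive (_⊑_ {k})
  ⊑-trans {_} {_} {_} {c} (J , eq) (J′ , eq′) = J′ ∘ₑ J , λ f g →
    trans (eq f g) (trans (eq′ (J ∘ₑ f) (J ∘ₑ g)) (⟦⟧-cong c (id , id) (id , id)))

  restrict-⊑ : (J : Embedding K K) (c : Colouring A K k) → restrict J c ⊑ c
  restrict-⊑ J c = J , λ f g → refl

  -- A lower bound on the number of colours, phrased through upper bounds because sizes are
  -- expressed by `∣_∣≤_`. Ranging over everything below `c` makes it hereditary.
  Persistent : ℕ → Pred (Colouring A K k) ℓ
  Persistent t c = ∀ {c′} → c′ ⊑ c → ∀ s → ∣ range c′ ∣≤ s → t ≤ s

  range-cong : {c c′ : Colouring A K k} → (∀ f g → ⟦ c ⟧ f g ≡ ⟦ c′ ⟧ f g) →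
               range c ≐ range c′
  range-cong eq = (λ (f , g , c≡i) → f , g , trans (sym (eq f g)) c≡i) ,
                  (λ (f , g , c≡i) → f , g , trans (eq f g) c≡i)

  trivialColouring : Colouring A K 1
  trivialColouring = record { to = λ _ → 0F ; cong = λ _ → refl }

  -- Minimality is applied to `r`, one below the degree: if every colouring had a copy of `K` with
  -- at most `r` colours, `r` would be a bound. At degree zero the lower bound is vacuous.
  persistent-exists : ExcludedMiddle ℓ → IsBoxRamseyDegree A K t →
                      ∃[ k ] ∃[ c ] Persistent {k} t c
  persistent-exists {zero}  em _ = 1 , trivialColouring , λ _ _ _ → z≤n
  persistent-exists {suc r} em (_ , minimal)
    with em {∃[ k ] ∃ λ (c : Colouring A K k) → ¬ (∃[ J ] ∣ _[_]² A K c J ∣≤ r)}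
  ... | no ¬∃ = contradiction (minimal r bound) (<⇒≱ ≤-refl)
    where
    bound : BoxRamseyBound A K r
    bound k c with em {∃[ J ] ∣ _[_]² A K c J ∣≤ r}
    ... | yes ∃J = ∃J
    ... | no ¬∃J = contradiction (k , c , ¬∃J) ¬∃
  ... | yes (k , c , ¬∃J) = k , c , λ {c′} → persistent {c′}
    where
    persistent : Persistent (suc r) c
    persistent {c′} (J , eq) s range≤s = ≰⇒> λ s≤r → ¬∃J
      (J , ∣∣≤-resp-≐ (swap ([]²≐range c J))
             (∣∣≤-resp-≐ (range-cong {c = c′} {restrict J c} eq) (∣∣≤-mono s≤r range≤s)))

  -- Relations induced by sets of colours.

  Induced : Colouring A K k → Subset k → Rel Copy ℓ
  Induced c S f g = Lift ℓ (⟦ c ⟧ f g Subset.∈ S)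

  -- Always an equivalence relation, so no case distinction on S is needed to
  -- define the basis.
  indistinguishable : Colouring A K k → Subset k → EquivRel A K
  indistinguishable c S = record
    { _∼_           = λ f g → ∀ h → Induced c S f h ⇔ Induced c S g h
    ; isEquivalence = record
      { refl  = λ h → mk⇔ id id
      ; sym   = λ p h → mk⇔ (⇐ (p h)) (⇒ (p h))
      ; trans = λ p q h → mk⇔ (⇒ (q h) ∘ ⇒ (p h)) (⇐ (p h) ∘ ⇐ (q h))
      }
    ; respects-≈    = λ f≈g h → let eq = ⟦⟧-cong c {g = h} f≈g (id , id) in
        mk⇔ (λ (lift i) → lift (subst (Subset._∈ S) eq i))
            (λ (lift i) → lift (subst (Subset._∈ S) (sym eq) i))
    }

  -- For an equivalence relation, having the same related elements amounts to being related; one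
  -- direction tests with `h = g`.
  indistinguishable⇔Induced : (c : Colouring A K k) (S : Subset k) →
    IsEquivalence (Induced c S) → ∀ {f g} → _∼_ (indistinguishable c S) f g ⇔ Induced c S f g
  indistinguishable⇔Induced c S eq {f} {g} = mk⇔
    (λ p → ⇐ (p g) R.refl)
    (λ f∼g h → mk⇔ (R.trans (R.sym f∼g)) (R.trans f∼g))
    where module R = IsEquivalence eq

  -- `Induced c′ S` is the pullback of `Induced c S` along `f ↦ J ∘ₑ f`.
  IsEquivalence-antitone : {S : Subset k} {c c′ : Colouring A K k} → c′ ⊑ c →
    IsEquivalence (Induced c S) → IsEquivalence (Induced c′ S)
  IsEquivalence-antitone {S = S} {c} {c′} (J , eq) equiv = record
    { refl  = λ {f} → pull {f} {f} R.refl
    ; sym   = λ {f} {g} p → pull {g} {f} (R.sym (push {f} {g} p))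
    ; trans = λ {f} {g} {h} p q → pull {f} {h} (R.trans (push {f} {g} p) (push {g} {h} q))
    }
    where
    module R = IsEquivalence equiv
    push : ∀ {f g} → Induced c′ S f g → Induced c S (J ∘ₑ f) (J ∘ₑ g)
    push {f} {g} (lift i) = lift (subst (Subset._∈ S) (eq f g) i)
    pull : ∀ {f g} → Induced c S (J ∘ₑ f) (J ∘ₑ g) → Induced c′ S f g
    pull {f} {g} (lift i) = lift (subst (Subset._∈ S) (sym (eq f g)) i)

  -- Refining a colouring by an equivalence relation.

  module _ (em : ExcludedMiddle ℓ) where

    related? : (E : EquivRel A K) → Copy → Copy → Fin 2
    related? E f g = indicator (em {_∼_ E f g})

    refine : Colouring A K k → EquivRel A K → Colouring A K (k * 2)
    refine c E = record
      { to   = λ (f , g) → combine (⟦ c ⟧ f g) (related? E f g)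
      ; cong = λ {(f , g)} {(f′ , g′)} (f≈f′ , g≈g′) →
          cong₂ combine (⟦⟧-cong c {f} {f′} {g} {g′} f≈f′ g≈g′) (indicator-cong em em
            (mk⇔ (∼-resp-≈ E {f} {f′} {g} {g′} f≈f′ g≈g′)
                 (∼-resp-≈ E {f′} {f} {g′} {g} (swap f≈f′) (swap g≈g′))))
      }

    quotient-range-refine : (c : Colouring A K k) (E : EquivRel A K) (J : Embedding K K) →
      (λ i → ∃[ z ] range (restrict J (refine c E)) z × quotient 2 z ≡ i) ≐ range (restrict J c)
    quotient-range-refine c E J =
      (λ { (_ , (f , g , refl) , refl) → f , g , sym (quotient-refine f g) }) ,
      (λ { (f , g , refl) → _ , (f , g , refl) , quotient-refine f g })
      where
      quotient-refine : ∀ f g → quotient 2 (⟦ restrict J (refine c E) ⟧ f g) ≡ ⟦ restrict J c ⟧ f g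
      quotient-refine f g = quotient-combine (⟦ restrict J c ⟧ f g) _

    -- `quotient 2` maps the at most `t` surviving refined colours onto the colours of
    -- `restrict J c`, of which persistence leaves no fewer than `t`. Hence it is injective there,
    -- and the colour under `c` decides `E`.
    persistent⇒induced : (c : Colouring A K k) → Persistent t c → BoxRamseyBound A K t →
      (E : EquivRel A K) →
      ∃[ J ] ∃[ S ] ∀ f g → _∼_ E (J ∘ₑ f) (J ∘ₑ g) ⇔ Induced (restrict J c) S f g
    persistent⇒induced {k} {t} c persistent bound E
      with J , ≤t ← bound (k * 2) (refine c E)
      with range≤t@(T , T⇔range , _) ← ∣∣≤-resp-≐ ([]²≐range (refine c E) J) ≤t
      = J , S , λ f g → mk⇔ (E⇒S f g) (S⇒E f g)
      where
      d = restrict J (refine c E)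

      related : Fin k → Fin (k * 2)
      related i = combine i 1F

      -- The colours that occur on `J` together with the bit for related pairs.
      S = preimage related T

      single-valued : ∀ {i : Fin k} {a b : Fin 2} → range d (combine i a) → range d (combine i b) → a ≡ b
      single-valued {i} {a} {b} ia∈ ib∈ with a ≟ b
      ... | yes a≡b = a≡b
      ... | no a≢b
        with s , s<t , range≤s ← ∣image∣<-collision (quotient 2) range≤t ia∈ ib∈
               (a≢b ∘ combine-injectiveʳ i a i b)
               (trans (quotient-combine i a) (sym (quotient-combine i b)))
        = contradiction
            (persistent {restrict J c} (restrict-⊑ J c) s (∣∣≤-resp-≐ (quotient-range-refine c E J) range≤s))
            (<⇒≱ s<t)

      E⇒S : ∀ f g → _∼_ E (J ∘ₑ f) (J ∘ₑ g) → Induced (restrict J c) S f g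
      E⇒S f g f∼g = lift (⇐ (∈-preimage related T) (⇐ (T⇔range _)
        (f , g , cong (combine (⟦ restrict J c ⟧ f g)) (⇒ (indicator≡1 em) f∼g))))

      S⇒E : ∀ f g → Induced (restrict J c) S f g → _∼_ E (J ∘ₑ f) (J ∘ₑ g)
      S⇒E f g (lift c∈S) = ⇐ (indicator≡1 em)
        -- Both the bit of this pair and `1F` occur over the same colour, so they coincide.
        (single-valued (f , g , refl) (⇒ (T⇔range _) (⇒ (∈-preimage related T) c∈S)))

    -- The finite Ramsey basis.

    Saturated : Pred (Colouring A K k) ℓ
    Saturated {k} c = ∀ S {c′ : Colouring A K k} → c′ ⊑ c →
                      IsEquivalence (Induced c′ S) → IsEquivalence (Induced c S)

    Basis : Colouring A K k → Pred (EquivRel A K) (Level.suc ℓ)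
    Basis c E = ∃[ S ] E ≡ indistinguishable c S

    basis-finite : (c : Colouring A K k) → IsFiniteSet A K (Basis c)
    basis-finite {k} c = map (indistinguishable c) (subsets k) , λ where
      _ (S , refl) → Any.map (Setoid.reflexive (EquivRels A K)) (∈-map⁺ (indistinguishable c) (∈-subsets S))

    -- On the copy found for `E`, the relation induced by `S` is `E` itself, hence an equivalence
    -- there. Saturation carries this to all of `K`, where the basis element for `S` then equals the
    -- induced relation.
    basis-ramsey : (c : Colouring A K k) → Persistent t c → Saturated c →
                   BoxRamseyBound A K t → IsRamseyBasis A K (Basis c)
    basis-ramsey c persistent saturated bound E
      with J , S , E⇔S ← persistent⇒induced c (λ {c′} → persistent {c′}) bound E
      = indistinguishable c S , (S , refl) , J ,
        (λ {(f , f∈J)} {(g , g∈J)} → ⇒ (agree f f∈J g g∈J)) ,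
        (λ {(f , f∈J)} {(g , g∈J)} → ⇐ (agree f f∈J g g∈J))
      where
      module E = IsEquivalence (isEquivalence E)

      equiv : IsEquivalence (Induced (restrict J c) S)
      equiv = record
        { refl  = λ {f} → ⇒ (E⇔S f f) E.refl
        ; sym   = λ {f} {g} p → ⇒ (E⇔S g f) (E.sym (⇐ (E⇔S f g) p))
        ; trans = λ {f} {g} {h} p q → ⇒ (E⇔S f h) (E.trans (⇐ (E⇔S f g) p) (⇐ (E⇔S g h) q))
        }

      agree : ∀ f → f ∈ CopiesIn A K J → ∀ g → g ∈ CopiesIn A K J →
              _∼_ E f g ⇔ _∼_ (indistinguishable c S) f g
      agree f f∈J g g∈J
        -- `E⇔S` speaks of copies of the form `J ∘ₑ f′`; factoring replaces `f` and `g` by such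
        -- copies up to `_≈_`.
        with f′ , Jf′≈f ← factor J f f∈J
        with g′ , Jg′≈g ← factor J g g∈J
        = mk⇔
          (∼-resp-≈ F {J ∘ₑ f′} {f} {J ∘ₑ g′} {g} Jf′≈f Jg′≈g ∘ ⇐ F⇔S ∘ ⇒ (E⇔S f′ g′)
            ∘ ∼-resp-≈ E {f} {J ∘ₑ f′} {g} {J ∘ₑ g′} (swap Jf′≈f) (swap Jg′≈g))
          (∼-resp-≈ E {J ∘ₑ f′} {f} {J ∘ₑ g′} {g} Jf′≈f Jg′≈g ∘ ⇐ (E⇔S f′ g′) ∘ ⇒ F⇔S
            ∘ ∼-resp-≈ F {f} {J ∘ₑ f′} {g} {J ∘ₑ g′} (swap Jf′≈f) (swap Jg′≈g))
        where
        F = indistinguishable c S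
        F⇔S : _∼_ F (J ∘ₑ f′) (J ∘ₑ g′) ⇔ Induced c S (J ∘ₑ f′) (J ∘ₑ g′)
        F⇔S = indistinguishable⇔Induced c S (saturated S {restrict J c} (restrict-⊑ J c) equiv)
                {J ∘ₑ f′} {J ∘ₑ g′}

theorem3p12 : ∀ {ℓ : Level} → ExcludedMiddle ℓ →
    ∀ {L : Language ℓ} (K : Structure L) → Infinite K →
    ∀ (A : Structure L) → A ∈Age K →
    BoxRamseyDegree<∞ A K →
    ∃[ ℬ ] IsFiniteSet A K ℬ × IsRamseyBasis A K ℬ
theorem3p12 em K _ A _ (t , degree@(bound , _))
  with k , c₀ , persistent ← persistent-exists A K em degree
  -- The indices run over all sets of colours, so the resulting colouring is saturated; lying below
  -- `c₀`, it stays persistent.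
  with c , c⊑c₀ , stable ← stabilise em (_⊑_ A K)
         (λ {x} → ⊑-refl A K {x = x}) (λ {x} {y} {z} → ⊑-trans A K {_} {x} {y} {z})
         (λ S c → IsEquivalence (Induced A K c S))
         (λ {S} {c} {c′} → IsEquivalence-antitone A K {S = S} {c} {c′})
         (subsets k) c₀
  = Basis A K em c , basis-finite A K em c ,
    basis-ramsey A K em c
      (λ {c′} c′⊑c → persistent {c′} (⊑-trans A K {_} {c′} {c} {c₀} c′⊑c c⊑c₀))
      (λ S {c′} c′⊑c → stable (∈-subsets S) {c′} c′⊑c)
      bound
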